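{- Let $V=\{1,\dots,n\}$, let $1\le t\le n$, let $\mathcal B$ be a set of subsets of $V$ and let $w:\mathcal B\to\mathbb R_{>0}$. Assume that $(V,\mathcal B,w)$ is both $t$-wise balanced and $(t-1)$-wise balanced, and for $j\in\{t-1,t\}$ let $\lambda_j$ be the constant value of $\sum_{B\in\mathcal B,\ Z\subset B}w(B)$ over all $j$-element subsets $Z\subset V$. Assume that every block in $\mathcal B$ has size $r_1$ or $r_2$, where $r_1\neq r_2$, put $\mathcal B_{r_\nu}=\{B\in\mathcal B: |B|=r_\nu\}$ for $\nu=1,2$, and assume that $w$ is equal to a constant $w_{r_\nu}$ on $\mathcal B_{r_\nu}$ for $\nu=1,2$. Then, for $\nu=1,2$, $(V,\mathcal B_{r_\nu})$ is a combinatorial $(t-1)$-$(n,r_\nu,\lambda^{(r_\nu)}_{t-1})$ design, with $$\lambda^{(r_1)}_{t-1}=\frac{(r_2-t+1)\lambda_{t-1}-(n-t+1)\lambda_t}{(r_2-r_1)w_{r_1}},\qquad \lambda^{(r_2)}_{t-1}=\frac{(r_1-t+1)\lambda_{t-1}-(n-t+1)\lambda_t}{(r_1-r_2)w_{r_2}}.$$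
   Context: For a set $\mathcal B$ of subsets of $V=\{1,\dots,n\}$ with positive weight function $w$, $(V,\mathcal B,w)$ is called $j$-wise balanced if the sum $\sum_{B\in\mathcal B,\ Z\subset B}w(B)$ is the same constant $\lambda_j$ for all $j$-element subsets $Z\subset V$. A combinatorial $s$-$(n,k,\lambda)$ design is a pair $(V,\mathcal B)$ with $|V|=n$ and $\mathcal B$ a set of $k$-element subsets of $V$ (blocks) such that every $s$-element subset of $V$ is contained in exactly $\lambda$ blocks ($\lambda=0$ is allowed). -}

module Defs where

open import Level using (suc; _⊔_)
open import Data.Nat as ℕ using (ℕ; zero)
import Data.Nat.Properties as ℕₚ
open import Data.Empty using (⊥-elim)
open import Data.Fin.Subset using (Subset; ∣_∣; _⊆_)
open import Data.Fin.Subset.Properties using (_⊆?_)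
open import Data.List using (List; foldr; map; filter; length)
open import Data.List.Relation.Unary.All using (All)
open import Data.List.Relation.Unary.Unique.Propositional using (Unique)
open import Data.Product using (_,_; proj₁)
open import Data.Sum using (_⊎_)
open import Relation.Binary.Core using (Rel)
open import Relation.Binary.Definitions using (tri<; tri≈; tri>)
open import Relation.Binary.Structures using (IsStrictPartialOrder)
open import Relation.Binary.PropositionalEquality using (_≡_; _≢_)
import Relation.Binary.PropositionalEquality as ≡
open import Algebra.Bundles using (CommutativeRing)
open import Algebra.Apartness.Bundles using (HeytingCommutativeRing; HeytingField)
import Algebra.Apartness.Properties.HeytingCommutativeRing as HeytingProperties
import Algebra.Definitions.RawMonoid as RawMonoidDefs

-- The scalars.  The standard library has no real numbers, so weights take
-- values in an arbitrary ordered field.  The axioms are phrased with an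
-- apartness relation so that they hold for the constructive (Cauchy or
-- Dedekind) reals, where < and ≈ are undecidable; classically _#_ is just
-- inequality and this is the usual notion of an ordered field.
record OrderedField c ℓ₁ ℓ₂ ℓ₃ : Set (suc (c ⊔ ℓ₁ ⊔ ℓ₂ ⊔ ℓ₃)) where
  infix 4 _<_
  field
    heytingField : HeytingField c ℓ₁ ℓ₂

  open HeytingField heytingField public

  field
    _<_                  : Rel Carrier ℓ₃
    isStrictPartialOrder : IsStrictPartialOrder _≈_ _<_
    #⇒<⊎>                : ∀ {x y} → x # y → x < y ⊎ y < x
    <⇒#                  : ∀ {x y} → x < y → x # y
    0<1                  : 0# < 1#
    +-monoˡ-<            : ∀ z {x y} → x < y → x + z < y + z
    *-pos                : ∀ {x y} → 0# < x → 0# < y → 0# < x * y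

  module < = IsStrictPartialOrder isStrictPartialOrder

  commutativeRing : CommutativeRing c ℓ₁
  commutativeRing = HeytingCommutativeRing.commutativeRing heytingCommutativeRing

  open RawMonoidDefs (CommutativeRing.+-rawMonoid commutativeRing)
    using () renaming (_×_ to _·_)

  fromℕ : ℕ → Carrier
  fromℕ m = m · 1#

  infixl 7 _/_[_]

  -- #⇒invertible yields an inverse of y - 0#, which equals y.
  _/_[_] : Carrier → (y : Carrier) → y # 0# → Carrier
  x / y [ y#0 ] = x * proj₁ (#⇒invertible y#0)

  open HeytingProperties heytingCommutativeRing
    using (x-0≈x; x#0y#0→xy#0)

  x#y⇒x-y#0 : ∀ {x y} → x # y → x - y # 0#
  x#y⇒x-y#0 {x} {y} x#y with #⇒invertible x#y
  ... | z , zd≈1 , dz≈1 = invertible⇒#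
    (z , trans (*-congˡ (x-0≈x (x - y))) zd≈1
       , trans (*-congʳ (x-0≈x (x - y))) dz≈1)

  fromℕ-step : ∀ m → fromℕ m < fromℕ (ℕ.suc m)
  fromℕ-step m =
    <.<-respˡ-≈ (+-identityˡ (fromℕ m)) (+-monoˡ-< (fromℕ m) 0<1)

  fromℕ-mono-<′ : ∀ {l m} → l ℕ.<′ m → fromℕ l < fromℕ m
  fromℕ-mono-<′ {l} (ℕ.≤′-reflexive ≡.refl) = fromℕ-step l
  fromℕ-mono-<′ {m = ℕ.suc m} (ℕ.≤′-step l<m) =
    <.trans (fromℕ-mono-<′ l<m) (fromℕ-step m)

  fromℕ-mono-< : ∀ {l m} → l ℕ.< m → fromℕ l < fromℕ m
  fromℕ-mono-< l<m = fromℕ-mono-<′ (ℕₚ.≤⇒≤′ l<m)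

  fromℕ-# : ∀ {l m} → l ≢ m → fromℕ l # fromℕ m
  fromℕ-# {l} {m} l≢m with ℕₚ.<-cmp l m
  ... | tri< l<m _ _ = <⇒# (fromℕ-mono-< l<m)
  ... | tri≈ _ l≡m _ = ⊥-elim (l≢m l≡m)
  ... | tri> _ _ m<l = #-sym (<⇒# (fromℕ-mono-< m<l))

  [l-m]x#0 : ∀ {l m x} → l ≢ m → 0# < x → (fromℕ l - fromℕ m) * x # 0#
  [l-m]x#0 l≢m 0<x =
    x#0y#0→xy#0 (x#y⇒x-y#0 (fromℕ-# l≢m)) (#-sym (<⇒# 0<x))


-- A set of subsets of V = Fin n is a duplicate-free list.

blocksContaining : ∀ {n} → Subset n → List (Subset n) → List (Subset n)
blocksContaining Z = filter (Z ⊆?_)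

blocksOfSize : ∀ {n} → ℕ → List (Subset n) → List (Subset n)
blocksOfSize r = filter (λ B → ∣ B ∣ ℕ.≟ r)

record IsDesign (s n k l : ℕ) (ℬ : List (Subset n)) : Set where
  field
    distinct : Unique ℬ
    uniform  : All (λ B → ∣ B ∣ ≡ k) ℬ
    covered  : ∀ (Z : Subset n) → ∣ Z ∣ ≡ s →
               length (blocksContaining Z ℬ) ≡ l

module Weighted {c ℓ₁ ℓ₂ ℓ₃} (K : OrderedField c ℓ₁ ℓ₂ ℓ₃) where
  open OrderedField K

  sumOver : ∀ {n} → (Subset n → Carrier) → List (Subset n) → Carrier
  sumOver w ℬ = foldr _+_ 0# (map w ℬ)

  -- j-wise balanced, with constant value l.  Only the values of w on ℬ matter.
  IsBalanced : ∀ {n} (j : ℕ) (ℬ : List (Subset n)) (w : Subset n → Carrier) →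
               Carrier → Set ℓ₁
  IsBalanced {n} j ℬ w l =
    ∀ (Z : Subset n) → ∣ Z ∣ ≡ j → sumOver w (blocksContaining Z ℬ) ≈ l

-- Fix a (t-1)-set Z and let s = t-1.  Counting the pairs (x, B) with x ∉ Z and
-- Z ∪ {x} ⊆ B, weighted by w B, in two ways gives
--   ∑_{B ⊇ Z} (|B| - s) w(B) = (n - s) λₜ.
-- Subtracting this from (r' - s) ∑_{B ⊇ Z} w(B) = (r' - s) λₜ₋₁ leaves
--   ∑_{B ⊇ Z} (r' - |B|) w(B),
-- in which the blocks of size r' drop out and those of size r contribute the
-- constant (r' - r) wᵣ.  Hence the number of blocks of size r above Z is the
-- claimed quotient; it does not depend on Z because fromℕ is injective.
module Submission where

open import Defs
import Data.Nat as ℕ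
open import Data.Nat using (ℕ; suc; _≤_; _∸_; z≤n; s≤s)
import Data.Nat.Properties as ℕₚ
open import Data.Bool using (true; false)
open import Data.Fin.Subset using (Subset; ∣_∣; inside; outside; _⊆_; _⊈_; ⊥)
open import Data.Fin.Subset.Properties
  using (_⊆?_; ∣⊥∣≡0; out⊆; s⊆s; drop-∷-⊆; ⊆-refl)
open import Data.List using (List; []; _∷_; map; filter; length)
open import Data.List.Properties
  using (length-map; filter-accept; filter-reject; filter-none)
open import Data.List.Membership.Propositional using (_∈_)
open import Data.List.Membership.Propositional.Properties using (∈-filter⁺)
open import Data.List.Relation.Unary.All as All using (All; []; _∷_)
import Data.List.Relation.Unary.All.Properties as Allₚ
open import Data.List.Relation.Unary.Unique.Propositional using (Unique)
import Data.List.Relation.Unary.Unique.Propositional.Properties as Uniqueₚ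
open import Data.Product using (Σ-syntax; ∃-syntax; _×_; _,_)
open import Data.Sum using (_⊎_; inj₁; inj₂; swap)
open import Data.Vec using ([]; _∷_; here)
open import Function using (case_of_)
open import Relation.Binary.PropositionalEquality using (_≡_; _≢_; ≢-sym)
import Relation.Binary.PropositionalEquality as ≡
import Relation.Binary.Reasoning.Setoid as SetoidReasoning
open import Relation.Nullary using (yes; no; ¬_; does)
open import Relation.Nullary.Decidable using (decidable-stable)
open import Relation.Unary using (Pred; Decidable)
open import Algebra.Bundles using (CommutativeRing)
import Algebra.Apartness.Properties.HeytingCommutativeRing as HeytingProperties
import Algebra.Properties.AbelianGroup as AbelianGroupProperties
import Algebra.Properties.CommutativeSemigroup as CommutativeSemigroupProperties
import Algebra.Properties.Monoid.Mult as MonoidMult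
import Algebra.Properties.Ring as RingProperties

-- Finite subsets and their one-point extensions.

subsetOfSize : ∀ {s n} → s ≤ n → ∃[ Z ] ∣_∣ {n} Z ≡ s
subsetOfSize {n = n} z≤n = ⊥ , ∣⊥∣≡0 n
subsetOfSize (s≤s s≤n) with Z , ∣Z∣≡s ← subsetOfSize s≤n =
  inside ∷ Z , ≡.cong suc ∣Z∣≡s

-- The sets Z ∪ {x} with x ∉ Z, each listed once.
covers : ∀ {n} → Subset n → List (Subset n)
covers []            = []
covers (inside ∷ Z)  = map (inside ∷_) (covers Z)
covers (outside ∷ Z) = (inside ∷ Z) ∷ map (outside ∷_) (covers Z)

∣cover∣ : ∀ {n} (Z : Subset n) → All (λ Y → ∣ Y ∣ ≡ suc ∣ Z ∣) (covers Z)
∣cover∣ []            = []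
∣cover∣ (inside ∷ Z)  = Allₚ.map⁺ (All.map (≡.cong suc) (∣cover∣ Z))
∣cover∣ (outside ∷ Z) = ≡.refl ∷ Allₚ.map⁺ (∣cover∣ Z)

⊆-cover : ∀ {n} (Z : Subset n) → All (Z ⊆_) (covers Z)
⊆-cover []            = []
⊆-cover (inside ∷ Z)  = Allₚ.map⁺ (All.map s⊆s (⊆-cover Z))
⊆-cover (outside ∷ Z) = out⊆ ⊆-refl ∷ Allₚ.map⁺ (All.map s⊆s (⊆-cover Z))

-- Each point outside Z gives one cover. The additive form avoids truncated subtraction; it becomes
-- a difference only in the field.
length-covers : ∀ {n} (Z : Subset n) → length (covers Z) ℕ.+ ∣ Z ∣ ≡ n
length-covers []            = ≡.refl
length-covers (inside ∷ Z)  = ≡.trans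
  (≡.cong (ℕ._+ suc ∣ Z ∣) (length-map _ (covers Z)))
  (≡.trans (ℕₚ.+-suc _ ∣ Z ∣) (≡.cong suc (length-covers Z)))
length-covers (outside ∷ Z) = ≡.cong suc (≡.trans
  (≡.cong (ℕ._+ ∣ Z ∣) (length-map _ (covers Z))) (length-covers Z))

coversIn : ∀ {n} → Subset n → Subset n → List (Subset n)
coversIn Z B = filter (_⊆? B) (covers Z)

-- Comparing only the Boolean answers of the inclusion tests makes the hypothesis hold by `≡.refl`
-- for each pair of heads used below, since `_⊆?_` computes on heads.
length-filter-map-∷ : ∀ {n} a b (B : Subset n) →
  (∀ Y → does ((a ∷ Y) ⊆? (b ∷ B)) ≡ does (Y ⊆? B)) →
  ∀ Ys → length (filter (_⊆? (b ∷ B)) (map (a ∷_) Ys)) ≡ length (filter (_⊆? B) Ys)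
length-filter-map-∷ a b B same []       = ≡.refl
length-filter-map-∷ a b B same (Y ∷ Ys)
  with ih ← length-filter-map-∷ a b B same Ys
     | does ((a ∷ Y) ⊆? (b ∷ B)) | does (Y ⊆? B) | same Y
... | true  | _ | ≡.refl = ≡.cong suc ih
... | false | _ | ≡.refl = ih

-- When Z lies in B, the covers of Z inside B come from adding the points of B outside Z.
length-coversIn : ∀ {n} (Z B : Subset n) → Z ⊆ B →
                  length (coversIn Z B) ℕ.+ ∣ Z ∣ ≡ ∣ B ∣
length-coversIn []            []            Z⊆B = ≡.refl
length-coversIn (inside ∷ Z)  (outside ∷ B) Z⊆B = case Z⊆B here of λ ()
length-coversIn (inside ∷ Z)  (inside ∷ B)  Z⊆B = ≡.trans
  (≡.cong (ℕ._+ suc ∣ Z ∣)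
    (length-filter-map-∷ inside inside B (λ _ → ≡.refl) (covers Z)))
  (≡.trans (ℕₚ.+-suc _ ∣ Z ∣) (≡.cong suc (length-coversIn Z B (drop-∷-⊆ Z⊆B))))
-- The head cover `inside ∷ Z` is discarded by computation, since B lacks the first point.
length-coversIn (outside ∷ Z) (outside ∷ B) Z⊆B = ≡.trans
  (≡.cong (ℕ._+ ∣ Z ∣)
    (length-filter-map-∷ outside outside B (λ _ → ≡.refl) (covers Z)))
  (length-coversIn Z B (drop-∷-⊆ Z⊆B))
-- Here the head cover `inside ∷ Z` is kept and accounts for the first point of B.
length-coversIn (outside ∷ Z) (inside ∷ B)  Z⊆B = ≡.trans
  (≡.cong (λ Ys → length Ys ℕ.+ ∣ Z ∣)
    (filter-accept (_⊆? (inside ∷ B)) (s⊆s (drop-∷-⊆ Z⊆B))))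
  (≡.cong suc (≡.trans
    (≡.cong (ℕ._+ ∣ Z ∣)
      (length-filter-map-∷ outside inside B (λ _ → ≡.refl) (covers Z)))
    (length-coversIn Z B (drop-∷-⊆ Z⊆B))))

-- Every cover of Z contains Z, so a cover inside B would force Z into B.
coversIn-none : ∀ {n} {Z B : Subset n} → Z ⊈ B → coversIn Z B ≡ []
coversIn-none {Z = Z} {B} Z⊈B = filter-none (_⊆? B)
  (All.map {P = Z ⊆_} (λ Z⊆Y Y⊆B → Z⊈B (λ x∈Z → Y⊆B (Z⊆Y x∈Z))) (⊆-cover Z))

-- Arithmetic in the ordered field.

module _ {c ℓ₁ ℓ₂ ℓ₃} (K : OrderedField c ℓ₁ ℓ₂ ℓ₃) where
  open OrderedField K
  open Weighted K
  private
    module R = CommutativeRing commutativeRing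
  open AbelianGroupProperties R.+-abelianGroup
    using (//-rightDividesʳ; ⁻¹-∙-comm)
  open CommutativeSemigroupProperties R.+-commutativeSemigroup
    using (interchange; x∙yz≈y∙xz)
  open MonoidMult R.+-monoid using (×-homo-+)
  open RingProperties R.ring using ([y-z]x≈yx-zx)
  open HeytingProperties heytingCommutativeRing using (x-0≈x)
  open SetoidReasoning R.setoid

  -- Distinct naturals have images that are apart, which only refutes `l ≢ m`; decidable equality on
  -- ℕ removes the double negation.
  fromℕ-injective : ∀ {l m} → fromℕ l ≈ fromℕ m → l ≡ m
  fromℕ-injective {l} {m} eq =
    decidable-stable (l ℕ.≟ m) λ l≢m → #-irrefl eq (fromℕ-# l≢m)

  fromℕ-+⇒∸ : ∀ a b {m} → a ℕ.+ b ≡ m → fromℕ a ≈ fromℕ m - fromℕ b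
  fromℕ-+⇒∸ a b ≡.refl = begin
    fromℕ a                        ≈⟨ //-rightDividesʳ (fromℕ b) (fromℕ a) ⟨
    fromℕ a + fromℕ b - fromℕ b    ≈⟨ +-congʳ (×-homo-+ 1# a b) ⟨
    fromℕ (a ℕ.+ b) - fromℕ b      ∎

  -- Translates the coefficients x - t + 1 into x - s for t = s + 1, as `fromℕ (suc s)` unfolds to
  -- `1# + fromℕ s`.
  x-[1+y]+1≈x-y : ∀ x y → x - (1# + y) + 1# ≈ x - y
  x-[1+y]+1≈x-y x y = begin
    x - (1# + y) + 1#        ≈⟨ +-congʳ (+-congˡ (-‿cong (+-comm 1# y))) ⟩
    x - (y + 1#) + 1#        ≈⟨ +-congʳ (+-congˡ (⁻¹-∙-comm y 1#)) ⟨
    x + (- y - 1#) + 1#      ≈⟨ +-assoc x (- y - 1#) 1# ⟩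
    x + (- y - 1# + 1#)      ≈⟨ +-congˡ (+-assoc (- y) (- 1#) 1#) ⟩
    x + (- y + (- 1# + 1#))  ≈⟨ +-congˡ (+-congˡ (-‿inverseˡ 1#)) ⟩
    x + (- y + 0#)           ≈⟨ +-congˡ (+-identityʳ (- y)) ⟩
    x - y                    ∎

  [x-u]-[y-v] : ∀ x u y v → (x - u) - (y - v) ≈ (x - y) - (u - v)
  [x-u]-[y-v] x u y v = begin
    (x - u) - (y - v)      ≈⟨ +-congˡ (⁻¹-∙-comm y (- v)) ⟨
    (x - u) + (- y - - v)  ≈⟨ interchange x (- u) (- y) (- - v) ⟩
    (x - y) + (- u - - v)  ≈⟨ +-congˡ (⁻¹-∙-comm u (- v)) ⟩
    (x - y) - (u - v)      ∎

  [x-z]-[y-z]≈x-y : ∀ x y z → (x - z) - (y - z) ≈ x - y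
  [x-z]-[y-z]≈x-y x y z = begin
    (x - z) - (y - z)  ≈⟨ [x-u]-[y-v] x z y z ⟩
    (x - y) - (z - z)  ≈⟨ +-congˡ (-‿cong (-‿inverseʳ z)) ⟩
    (x - y) - 0#       ≈⟨ x-0≈x (x - y) ⟩
    x - y              ∎

  xy≈z⇒x≈z/y : ∀ {x y z} (y#0 : y # 0#) → x * y ≈ z → x ≈ z / y [ y#0 ]
  xy≈z⇒x≈z/y {x} {y} {z} y#0 xy≈z with y⁻¹ , _ , yy⁻¹≈1 ← #⇒invertible y#0 = begin
    x                     ≈⟨ *-identityʳ x ⟨
    x * 1#                ≈⟨ *-congˡ yy⁻¹≈1 ⟨
    x * ((y - 0#) * y⁻¹)  ≈⟨ *-congˡ (*-congʳ (x-0≈x y)) ⟩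
    x * (y * y⁻¹)         ≈⟨ *-assoc x y y⁻¹ ⟨
    x * y * y⁻¹           ≈⟨ *-congʳ xy≈z ⟩
    z * y⁻¹               ∎

  fromℕ-suc-* : ∀ m x → fromℕ (suc m) * x ≈ x + fromℕ m * x
  fromℕ-suc-* m x = trans (distribʳ x 1# (fromℕ m)) (+-congʳ (*-identityˡ x))

  -- Weighted sums over lists of sets, and double counting.

  sumOver-const : ∀ {n} {f : Subset n → Carrier} {x Ys} →
                  All (λ Y → f Y ≈ x) Ys → sumOver f Ys ≈ fromℕ (length Ys) * x
  sumOver-const {x = x} []                 = sym (zeroˡ x)
  sumOver-const {x = x} {_ ∷ Ys} (eq ∷ eqs) =
    trans (+-cong eq (sumOver-const eqs)) (sym (fromℕ-suc-* (length Ys) x))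

  sumOver-*‿- : ∀ {n} (f g : Subset n → Carrier) x Ys →
                sumOver (λ Y → x * f Y - g Y) Ys ≈ x * sumOver f Ys - sumOver g Ys
  sumOver-*‿- f g x []       = sym (trans (x-0≈x (x * 0#)) (zeroʳ x))
  sumOver-*‿- f g x (Y ∷ Ys) = begin
    (x * f Y - g Y) + sumOver (λ Y → x * f Y - g Y) Ys
      ≈⟨ +-congˡ (sumOver-*‿- f g x Ys) ⟩
    (x * f Y - g Y) + (x * F - G)
      ≈⟨ interchange (x * f Y) (- g Y) (x * F) (- G) ⟩
    (x * f Y + x * F) + (- g Y - G)
      ≈⟨ +-cong (sym (distribˡ x (f Y) F)) (⁻¹-∙-comm (g Y) G) ⟩
    x * (f Y + F) - (g Y + G) ∎
    where
    F = sumOver f Ys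
    G = sumOver g Ys

  -- A summand that is constant on Q and zero off Q turns a sum into a count. It is applied with P
  -- as "contains Z" and Q as "has size r".
  sumOver-filter : ∀ {n p q} {P : Pred (Subset n) p} {Q : Pred (Subset n) q}
    (P? : Decidable P) (Q? : Decidable Q) {h : Subset n → Carrier} {x ℬ} →
    All (λ B → (Q B × h B ≈ x) ⊎ (¬ Q B × h B ≈ 0#)) ℬ →
    sumOver h (filter P? ℬ) ≈ fromℕ (length (filter P? (filter Q? ℬ))) * x
  sumOver-filter P? Q? {x = x} [] = sym (zeroˡ x)
  sumOver-filter P? Q? {x = x} {B ∷ ℬ} (inj₁ (q , eq) ∷ eqs)
    rewrite filter-accept Q? {xs = ℬ} q
    with ih ← sumOver-filter P? Q? eqs | does (P? B)
  ... | true  = trans (+-cong eq ih)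
    (sym (fromℕ-suc-* (length (filter P? (filter Q? ℬ))) x))
  ... | false = ih
  sumOver-filter P? Q? {x = x} {B ∷ ℬ} (inj₂ (¬q , eq) ∷ eqs)
    rewrite filter-reject Q? {xs = ℬ} ¬q
    with ih ← sumOver-filter P? Q? eqs | does (P? B)
  ... | true  = trans (+-cong eq ih) (+-identityˡ _)
  ... | false = ih

  -- The block B enters the inner sum once for each Y in `Ys` with Y ⊆ B; these contributions are
  -- collected in front.
  doubleCount-∷ : ∀ {n} (f : Subset n → Carrier) B ℬ Ys →
    sumOver (λ Y → sumOver f (blocksContaining Y (B ∷ ℬ))) Ys ≈
    fromℕ (length (filter (_⊆? B) Ys)) * f B +
      sumOver (λ Y → sumOver f (blocksContaining Y ℬ)) Ys
  doubleCount-∷ f B ℬ []       = sym (trans (+-identityʳ _) (zeroˡ (f B)))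
  doubleCount-∷ f B ℬ (Y ∷ Ys) with ih ← doubleCount-∷ f B ℬ Ys | does (Y ⊆? B)
  ... | false = trans (+-congˡ ih) (x∙yz≈y∙xz _ _ _)
  ... | true  = begin
    (f B + S) + _               ≈⟨ +-congˡ ih ⟩
    (f B + S) + (k * f B + T)   ≈⟨ interchange (f B) S (k * f B) T ⟩
    (f B + k * f B) + (S + T)   ≈⟨ +-congʳ (fromℕ-suc-* m (f B)) ⟨
    (1# + k) * f B + (S + T)    ∎
    where
    S = sumOver f (blocksContaining Y ℬ)
    T = sumOver (λ Y → sumOver f (blocksContaining Y ℬ)) Ys
    m = length (filter (_⊆? B) Ys)
    k = fromℕ m

  -- Interchanges the order of summation over the pairs (Y, B) with Y ⊆ B, one block at a time.
  doubleCount : ∀ {n} (f : Subset n → Carrier) ℬ Ys →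
    sumOver (λ Y → sumOver f (blocksContaining Y ℬ)) Ys ≈
    sumOver (λ B → fromℕ (length (filter (_⊆? B) Ys)) * f B) ℬ
  doubleCount f []      Ys =
    trans (sumOver-const {x = 0#} (All.universal (λ _ → refl) Ys)) (zeroʳ _)
  doubleCount f (B ∷ ℬ) Ys =
    trans (doubleCount-∷ f B ℬ Ys) (+-congˡ (doubleCount f ℬ Ys))

  -- Blocks not above Z contain no cover of Z and drop out; a block B above Z contains |B| - |Z| of
  -- them.
  sumOver-coversIn : ∀ {n} (f : Subset n → Carrier) Z ℬ →
    sumOver (λ B → fromℕ (length (coversIn Z B)) * f B) ℬ ≈
    sumOver (λ B → (fromℕ (∣ B ∣) - fromℕ (∣ Z ∣)) * f B) (blocksContaining Z ℬ)
  sumOver-coversIn f Z []      = refl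
  sumOver-coversIn f Z (B ∷ ℬ) with ih ← sumOver-coversIn f Z ℬ | Z ⊆? B
  ... | yes Z⊆B = +-cong
    (*-congʳ (fromℕ-+⇒∸ (length (coversIn Z B)) ∣ Z ∣ (length-coversIn Z B Z⊆B))) ih
  ... | no  Z⊈B rewrite coversIn-none {Z = Z} {B} Z⊈B =
    trans (+-cong (zeroˡ (f B)) ih) (+-identityˡ _)

  -- The n - |Z| covers of Z have size |Z| + 1, so balance gives each of them the same weight l;
  -- counting by blocks instead yields the left side.
  balanced⇒sumOver-excess : ∀ {n} (ℬ : List (Subset n)) w {l} Z →
    IsBalanced (suc ∣ Z ∣) ℬ w l →
    sumOver (λ B → (fromℕ (∣ B ∣) - fromℕ (∣ Z ∣)) * w B) (blocksContaining Z ℬ) ≈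
    (fromℕ n - fromℕ (∣ Z ∣)) * l
  balanced⇒sumOver-excess {n} ℬ w {l} Z bal = begin
    sumOver (λ B → (fromℕ (∣ B ∣) - fromℕ (∣ Z ∣)) * w B) (blocksContaining Z ℬ)
      ≈⟨ sumOver-coversIn w Z ℬ ⟨
    sumOver (λ B → fromℕ (length (coversIn Z B)) * w B) ℬ
      ≈⟨ doubleCount w ℬ (covers Z) ⟨
    sumOver (λ Y → sumOver w (blocksContaining Y ℬ)) (covers Z)
      ≈⟨ sumOver-const (All.map (bal _) (∣cover∣ Z)) ⟩
    fromℕ (length (covers Z)) * l
      ≈⟨ *-congʳ (fromℕ-+⇒∸ (length (covers Z)) ∣ Z ∣ (length-covers Z)) ⟩
    (fromℕ n - fromℕ (∣ Z ∣)) * l ∎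

  -- The number of blocks of one size above an s-set.

  module _ {n} {ℬ : List (Subset n)} {w : Subset n → Carrier} {s r r′ v λₛ λₛ₊₁}
    (r≢r′ : r ≢ r′) (sizes : All (λ B → ∣ B ∣ ≡ r ⊎ ∣ B ∣ ≡ r′) ℬ)
    (w≈v : All (λ B → w B ≈ v) (blocksOfSize r ℬ))
    (balₛ : IsBalanced s ℬ w λₛ) (balₛ₊₁ : IsBalanced (suc s) ℬ w λₛ₊₁) where

    blockCount : ∀ Z → ∣ Z ∣ ≡ s →
      fromℕ (length (blocksContaining Z (blocksOfSize r ℬ))) *
        ((fromℕ r′ - fromℕ r) * v) ≈
      (fromℕ r′ - fromℕ s) * λₛ - (fromℕ n - fromℕ s) * λₛ₊₁
    blockCount Z ≡.refl = begin
      fromℕ (length (blocksContaining Z (blocksOfSize r ℬ))) *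
        ((fromℕ r′ - fromℕ r) * v)
        ≈⟨ sumOver-filter (Z ⊆?_) (λ B → ∣ B ∣ ℕ.≟ r) (All.tabulate contribution) ⟨
      sumOver h (blocksContaining Z ℬ)
        ≈⟨ sumOver-*‿- w (λ B → (fromℕ (∣ B ∣) - fromℕ s) * w B) _
             (blocksContaining Z ℬ) ⟩
      (fromℕ r′ - fromℕ s) * sumOver w (blocksContaining Z ℬ) -
        sumOver (λ B → (fromℕ (∣ B ∣) - fromℕ s) * w B) (blocksContaining Z ℬ)
        ≈⟨ +-cong (*-congˡ (balₛ Z ≡.refl))
             (-‿cong (balanced⇒sumOver-excess ℬ w Z balₛ₊₁)) ⟩
      (fromℕ r′ - fromℕ s) * λₛ - (fromℕ n - fromℕ s) * λₛ₊₁ ∎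
      where
      -- This is (r′ - |B|) w B, left expanded so that its sum splits into the two balanced sums.
      h : Subset n → Carrier
      h B = (fromℕ r′ - fromℕ s) * w B - (fromℕ (∣ B ∣) - fromℕ s) * w B

      contribution : ∀ {B} → B ∈ ℬ →
        (∣ B ∣ ≡ r × h B ≈ (fromℕ r′ - fromℕ r) * v) ⊎ (∣ B ∣ ≢ r × h B ≈ 0#)
      contribution {B} B∈ℬ with All.lookup sizes B∈ℬ
      -- For |B| = r′ the two terms of `h` coincide and cancel.
      ... | inj₂ ≡.refl = inj₂ (≢-sym r≢r′ , -‿inverseʳ _)
      ... | inj₁ ≡.refl = inj₁ (≡.refl , (begin
        h B
          ≈⟨ [y-z]x≈yx-zx (w B) _ _ ⟨
        (fromℕ r′ - fromℕ s - (fromℕ r - fromℕ s)) * w B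
          ≈⟨ *-cong ([x-z]-[y-z]≈x-y _ _ _)
               (All.lookup w≈v (∈-filter⁺ (λ B → ∣ B ∣ ℕ.≟ r) B∈ℬ ≡.refl)) ⟩
        (fromℕ r′ - fromℕ r) * v ∎))

    design : s ≤ n → Unique ℬ → (d#0 : (fromℕ r′ - fromℕ r) * v # 0#) →
      Σ[ l ∈ ℕ ]
        IsDesign s n r l (blocksOfSize r ℬ) ×
        fromℕ l ≈
          ((fromℕ r′ - fromℕ (suc s) + 1#) * λₛ - (fromℕ n - fromℕ (suc s) + 1#) * λₛ₊₁)
            / ((fromℕ r′ - fromℕ r) * v) [ d#0 ]
    design s≤n unique d#0 with Z₀ , ∣Z₀∣≡s ← subsetOfSize s≤n =
      -- Since s ≤ n there is some s-set Z₀, and its degree serves as the design constant; all other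
      -- degrees have the same image in the field.
      degree Z₀ ,
      record
        { distinct = Uniqueₚ.filter⁺ (λ B → ∣ B ∣ ℕ.≟ r) unique
        ; uniform  = Allₚ.all-filter (λ B → ∣ B ∣ ℕ.≟ r) ℬ
        ; covered  = λ Z ∣Z∣≡s →
            fromℕ-injective (trans (quotient Z ∣Z∣≡s) (sym (quotient Z₀ ∣Z₀∣≡s)))
        } ,
      quotient Z₀ ∣Z₀∣≡s
      where
      degree : Subset n → ℕ
      degree Z = length (blocksContaining Z (blocksOfSize r ℬ))

      quotient : ∀ Z → ∣ Z ∣ ≡ s → fromℕ (degree Z) ≈
        ((fromℕ r′ - fromℕ (suc s) + 1#) * λₛ - (fromℕ n - fromℕ (suc s) + 1#) * λₛ₊₁)
          / ((fromℕ r′ - fromℕ r) * v) [ d#0 ]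
      quotient Z ∣Z∣≡s = xy≈z⇒x≈z/y d#0 (trans (blockCount Z ∣Z∣≡s)
        (+-cong (*-congʳ (sym (x-[1+y]+1≈x-y (fromℕ r′) (fromℕ s))))
          (-‿cong (*-congʳ (sym (x-[1+y]+1≈x-y (fromℕ n) (fromℕ s)))))))

theorem3p3 :
  ∀ {c ℓ₁ ℓ₂ ℓ₃} (K : OrderedField c ℓ₁ ℓ₂ ℓ₃) →
  let open OrderedField K
      open Weighted K in
  ∀ (n t : ℕ) → 1 ≤ t → t ≤ n →
  ∀ (ℬ : List (Subset n)) → Unique ℬ →
  ∀ (w : Subset n → Carrier) → All (λ B → 0# < w B) ℬ →
  ∀ (λₜ₋₁ λₜ : Carrier) → IsBalanced (t ∸ 1) ℬ w λₜ₋₁ → IsBalanced t ℬ w λₜ →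
  ∀ (r₁ r₂ : ℕ) (r₁≢r₂ : r₁ ≢ r₂) →
  All (λ B → ∣ B ∣ ≡ r₁ ⊎ ∣ B ∣ ≡ r₂) ℬ →
  ∀ (w₁ w₂ : Carrier) (0<w₁ : 0# < w₁) (0<w₂ : 0# < w₂) →
  All (λ B → w B ≈ w₁) (blocksOfSize r₁ ℬ) →
  All (λ B → w B ≈ w₂) (blocksOfSize r₂ ℬ) →
  (Σ[ l₁ ∈ ℕ ]
    IsDesign (t ∸ 1) n r₁ l₁ (blocksOfSize r₁ ℬ) ×
    fromℕ l₁ ≈
      ((fromℕ r₂ - fromℕ t + 1#) * λₜ₋₁ - (fromℕ n - fromℕ t + 1#) * λₜ)
        / ((fromℕ r₂ - fromℕ r₁) * w₁) [ [l-m]x#0 (≢-sym r₁≢r₂) 0<w₁ ])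
  ×
  (Σ[ l₂ ∈ ℕ ]
    IsDesign (t ∸ 1) n r₂ l₂ (blocksOfSize r₂ ℬ) ×
    fromℕ l₂ ≈
      ((fromℕ r₁ - fromℕ t + 1#) * λₜ₋₁ - (fromℕ n - fromℕ t + 1#) * λₜ)
        / ((fromℕ r₁ - fromℕ r₂) * w₂) [ [l-m]x#0 r₁≢r₂ 0<w₂ ])
-- Writing t as `suc s` makes `t ∸ 1` compute to s. The two halves differ by exchanging the two
-- sizes.
theorem3p3 K n (suc s) _ s<n ℬ unique w _ λₛ λₛ₊₁ balₛ balₛ₊₁ r₁ r₂ r₁≢r₂ sizes
  w₁ w₂ 0<w₁ 0<w₂ w≈w₁ w≈w₂ =
  design K r₁≢r₂ sizes w≈w₁ balₛ balₛ₊₁ s≤n unique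
    ([l-m]x#0 (≢-sym r₁≢r₂) 0<w₁) ,
  design K (≢-sym r₁≢r₂) (All.map swap sizes) w≈w₂ balₛ balₛ₊₁ s≤n unique
    ([l-m]x#0 r₁≢r₂ 0<w₂)
  where
  open OrderedField K using ([l-m]x#0)
  s≤n = ℕₚ.<⇒≤ s<n
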